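{- Let $k\geq 1$ and let $L=\{U_1,\ldots,U_k\}$ be the first-order language with $k$ unary predicate symbols. Then every basic property of $L$ is regular; that is, for every $1\leq p\leq k$, every $\bar{s}=\langle i_1,\ldots,i_p\rangle$ with $1\leq i_1<\cdots<i_p\leq k$, and every $e\in\{0,1\}^k$, the property $\phi_{\bar{s},e}(x)=U_{i_1}^{e(i_1)}(x)\wedge\cdots\wedge U_{i_p}^{e(i_p)}(x)$ is regular. In particular every property $\phi_e(x)=U_1^{e(1)}(x)\wedge\cdots\wedge U_k^{e(k)}(x)$, $e\in\{0,1\}^k$, as well as every $U_i(x)$ and $\neg U_i(x)$, for $i=1,\ldots,k$, is regular.
   Context: For a predicate symbol $U_i$ put $U_i^{1}(x)=U_i(x)$ and $U_i^{0}(x)=\neg U_i(x)$. For a language $L$ let $\mathbf{S}_n(L)$ be the set of $L$-structures with universe $\{1,\ldots,n\}$. For a formula $\phi(x)$ of $L$ with one free variable and without parameters (a "property"), and an $L$-structure $\mathcal{M}$ with universe $M$, let $\phi(\mathcal{M})=\{a\in M:\mathcal{M}\models\phi(a)\}$. Let $\mathbf{S}_{2n}(\phi:\mathrm{ntr})=\{\mathcal{M}\in\mathbf{S}_{2n}(L):|\phi(\mathcal{M})|=n\}$ (the structures of size $2n$ for which $\phi$ is neutral), $d_{2n}(\phi:\mathrm{ntr})=|\mathbf{S}_{2n}(\phi:\mathrm{ntr})|/|\mathbf{S}_{2n}(L)|$, and $d(\phi:\mathrm{ntr})=\lim_{n\to\infty}d_{2n}(\phi:\mathrm{ntr})$ whenever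 this limit exists. The property $\phi(x)$ is regular if $d(\phi:\mathrm{ntr})=0$. -}

module Defs where

open import Data.Bool using (Bool; true; false)
open import Data.Fin using (Fin)
open import Data.Fin.Properties using (all?) renaming (_≟_ to _≟ᶠ_)
open import Data.Fin.Subset using (Subset; _∈_; ∣_∣)
open import Data.Fin.Subset.Properties using (_∈?_)
open import Data.Integer using (+_)
open import Data.List using (List; []; _∷_; length; filter; cartesianProductWith)
open import Data.List.Membership.Propositional using () renaming (_∈_ to _∈ˡ_)
open import Data.List.Membership.Propositional.Properties using (∈-cartesianProductWith⁺)
open import Data.List.Relation.Unary.All using ([]; _∷_)
open import Data.List.Relation.Unary.AllPairs using ([]; _∷_)
open import Data.List.Relation.Unary.Any using (here; there)
open import Data.List.Relation.Unary.Unique.Propositional using (Unique)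
open import Data.List.Relation.Unary.Unique.Propositional.Properties using (cartesianProductWith⁺)
open import Data.Nat using (ℕ; zero; suc; _*_; _≥_; _≟_; NonZero)
open import Data.Product using (∃-syntax; _×_)
open import Data.Rational using (ℚ; 0ℚ; _<_; _-_; _/_) renaming (∣_∣ to abs)
open import Data.Vec using (Vec; []; _∷_; lookup; map; tabulate; foldr₁)
open import Data.Vec.Properties using (∷-injective)
open import Relation.Binary.PropositionalEquality using (_≡_; refl)
open import Relation.Nullary using (¬_; Dec; does; ¬?; _×-dec_)

-- Formula k m: first-order formulas, with equality, in the language of k unary
-- predicate symbols, whose free variables are among m variables (de Bruijn
-- indices). The remaining connectives and ∃ are the usual abbreviations.

data Formula (k : ℕ) : ℕ → Set where
  U    : ∀ {m} → Fin k → Fin m → Formula k m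
  _≐_  : ∀ {m} → Fin m → Fin m → Formula k m
  neg  : ∀ {m} → Formula k m → Formula k m
  _∧̇_  : ∀ {m} → Formula k m → Formula k m → Formula k m
  forAll : ∀ {m} → Formula k (suc m) → Formula k m

infixr 6 _∧̇_

Property : ℕ → Set
Property k = Formula k 1

-- Structures with universe Fin n (in place of {1,…,n}); entry i interprets the
-- i-th predicate symbol.

Structure : ℕ → ℕ → Set
Structure k n = Vec (Subset n) k

infix 4 _⊨_[_] _⊨?_[_]

_⊨_[_] : ∀ {k n m} → Structure k n → Formula k m → Vec (Fin n) m → Set
M ⊨ U i x [ ρ ]  = lookup ρ x ∈ lookup M i
M ⊨ x ≐ y [ ρ ]  = lookup ρ x ≡ lookup ρ y
M ⊨ neg φ [ ρ ]  = ¬ (M ⊨ φ [ ρ ])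
M ⊨ φ ∧̇ ψ [ ρ ]  = (M ⊨ φ [ ρ ]) × (M ⊨ ψ [ ρ ])
M ⊨ forAll φ [ ρ ]  = ∀ a → M ⊨ φ [ a ∷ ρ ]

_⊨?_[_] : ∀ {k n m} (M : Structure k n) (φ : Formula k m) (ρ : Vec (Fin n) m) →
          Dec (M ⊨ φ [ ρ ])
M ⊨? U i x [ ρ ]  = lookup ρ x ∈? lookup M i
M ⊨? x ≐ y [ ρ ]  = lookup ρ x ≟ᶠ lookup ρ y
M ⊨? neg φ [ ρ ]  = ¬? (M ⊨? φ [ ρ ])
M ⊨? φ ∧̇ ψ [ ρ ]  = (M ⊨? φ [ ρ ]) ×-dec (M ⊨? ψ [ ρ ])
M ⊨? forAll φ [ ρ ]  = all? (λ a → M ⊨? φ [ a ∷ ρ ])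

-- φ(M) = { a : M ⊨ φ(a) }

_⟨_⟩ : ∀ {k n} → Property k → Structure k n → Subset n
φ ⟨ M ⟩ = tabulate (λ a → does (M ⊨? φ [ a ∷ [] ]))

-- Cardinalities of sets of structures are lengths of sublists of
-- `structures k n`, which lists every structure exactly once
-- (structures-complete, structures-unique).

vecs : ∀ {A : Set} → List A → (n : ℕ) → List (Vec A n)
vecs xs zero    = [] ∷ []
vecs xs (suc n) = cartesianProductWith _∷_ xs (vecs xs n)

vecs-complete : ∀ {A : Set} {xs : List A} → (∀ a → a ∈ˡ xs) →
                ∀ {n} (v : Vec A n) → v ∈ˡ vecs xs n
vecs-complete c []      = here refl
vecs-complete c (a ∷ v) = ∈-cartesianProductWith⁺ _∷_ (c a) (vecs-complete c v)

vecs-unique : ∀ {A : Set} {xs : List A} → Unique xs → ∀ n → Unique (vecs xs n)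
vecs-unique u zero    = [] ∷ []
vecs-unique u (suc n) = cartesianProductWith⁺ _∷_ ∷-injective u (vecs-unique u n)

bools : List Bool
bools = true ∷ false ∷ []

structures : (k n : ℕ) → List (Structure k n)
structures k n = vecs (vecs bools n) k

structures-complete : ∀ {k n} (M : Structure k n) → M ∈ˡ structures k n
structures-complete = vecs-complete (vecs-complete λ where
  true  → here refl
  false → there (here refl))

structures-unique : ∀ k n → Unique (structures k n)
structures-unique k n =
  vecs-unique (vecs-unique (((λ ()) ∷ []) ∷ [] ∷ []) n) k

neutralStructures : ∀ {k} → Property k → (n : ℕ) → List (Structure k (2 * n))
neutralStructures {k} φ n = filter (λ M → ∣ φ ⟨ M ⟩ ∣ ≟ n) (structures k (2 * n))

∈⇒length-nonZero : ∀ {A : Set} {a : A} {xs} → a ∈ˡ xs → NonZero (length xs)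
∈⇒length-nonZero (here _)  = _
∈⇒length-nonZero (there _) = _

structures-nonZero : ∀ k n → NonZero (length (structures k n))
structures-nonZero k n =
  ∈⇒length-nonZero (structures-complete {k} {n} (tabulate λ _ → tabulate λ _ → true))

-- d₂ₙ(φ : ntr); the argument is n, not 2n.

neutralDensity : ∀ {k} → Property k → ℕ → ℚ
neutralDensity {k} φ n =
  (+ length (neutralStructures φ n) / length (structures k (2 * n)))
    {{structures-nonZero k (2 * n)}}

-- A rational ε suffices, since every positive real exceeds a positive rational.

_⟶_ : (ℕ → ℚ) → ℚ → Set
u ⟶ ℓ = ∀ ε → 0ℚ < ε → ∃[ N ] (∀ n → n ≥ N → abs (u n - ℓ) < ε)

Regular : ∀ {k} → Property k → Set
Regular φ = neutralDensity φ ⟶ 0ℚ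

-- U^[ true ] is U¹ and U^[ false ] is U⁰, applied to the only free variable.

U^[_] : ∀ {k} → Bool → Fin k → Property k
U^[ true ]  i = U i Fin.zero
U^[ false ] i = neg (U i Fin.zero)

⋀ : ∀ {k m p} .{{_ : NonZero p}} → Vec (Formula k m) p → Formula k m
⋀ {p = suc _} φs = foldr₁ _∧̇_ φs

basic : ∀ {k p} .{{_ : NonZero p}} → Vec (Fin k) p → (Fin k → Bool) → Property k
basic s e = ⋀ (map (λ i → U^[ e i ] i) s)

{-# OPTIONS --safe #-}

-- Let i be the first index of s. Once the predicates other than U_i are fixed,
-- φ(M) is the trace of U_i (or of its complement) on a fixed set B ⊆ [2n]. With
-- b = |B|, this trace has n elements for C(b,n) 2^(2n-b) ≤ C(2n,n) of the 2^(2n)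
-- interpretations of U_i, so the density is at most C(2n,n) / 4^n. This tends to 0,
-- because C(2n,n)² (2n+1) ≤ 16^n.
module Submission where

open import Defs
open import Data.Bool using (Bool; true; false; not; _∧_)
open import Data.Bool.Properties using (∧-identityʳ)
open import Data.Fin using (Fin; zero; suc; _<_)
open import Data.Fin.Properties using (<⇒≢)
open import Data.Fin.Subset using (Subset; ∣_∣)
open import Data.Fin.Subset.Properties using (_∈?_; ∣p∣≤n)
import Data.Integer as ℤ
import Data.Integer.Properties as ℤ
open import Data.List using (List; []; _∷_; _++_; map; length; filter; cartesianProductWith)
open import Data.List.Properties using (filter-++; filter-none; length-++; length-map; cartesianProductWith-zeroʳ)
open import Data.List.Relation.Binary.Permutation.Propositional using (_↭_; ↭-refl; ↭-reflexive; prep; module PermutationReasoning)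
open import Data.List.Relation.Binary.Permutation.Propositional.Properties using (↭-length; filter-↭; ++⁺ˡ; shifts)
open import Data.List.Relation.Unary.All using (universal)
open import Data.Nat using (ℕ; zero; suc; _+_; _*_; _∸_; _^_; _≤_; z≤n; s≤s; _≟_; NonZero)
import Data.Nat as ℕ
open import Data.Nat.Combinatorics using (_C_; nCk≡nC[n∸k]; nCn≡1; nC1≡n; k>n⇒nCk≡0; nCk+nC[k+1]≡[n+1]C[k+1])
open import Data.Nat.Coprimality using (Coprime)
open import Data.Nat.Properties hiding (_≟_; <⇒≢)
open import Data.Nat.Tactic.RingSolver using (solve-∀)
open import Data.Product using (_×_; _,_)
open import Data.Rational using (mkℚ; 0ℚ; _/_; _-_) renaming (∣_∣ to abs; _<_ to _<ℚ_; *<* to *<*ℚ)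
import Data.Rational.Properties as ℚ
open import Data.Rational.Unnormalised using (mkℚᵘ; *<*)
import Data.Rational.Unnormalised.Properties as ℚᵘ
open import Data.Vec using (Vec; []; _∷_; lookup; tabulate; replicate; zipWith; _[_]≔_; allFin)
open import Data.Vec.Properties using (lookup∘tabulate; tabulate∘lookup; tabulate-cong; lookup-zipWith; lookup∘updateAt; lookup∘updateAt′; lookup-replicate)
open import Data.Vec.Relation.Unary.All using (All; []; _∷_)
import Data.Vec.Relation.Unary.All as All
import Data.Vec.Relation.Unary.All.Properties as All
open import Data.Vec.Relation.Unary.AllPairs using (AllPairs; []; _∷_)
open import Function using (flip; _∘_)
open import Level using (0ℓ)
open import Relation.Binary.PropositionalEquality hiding ([_])
open import Relation.Nullary using (does)
open import Relation.Unary using (Pred; Decidable)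

-- Binomial coefficients: growth in the upper index and the size of the central one.

nC0≡1 : ∀ n → n C 0 ≡ 1
nC0≡1 n = trans (nCk≡nC[n∸k] {n = n} z≤n) (nCn≡1 n)

-- The absorption identity. Pascal's rule splits the left side, the induction hypothesis at `k` and
-- at `suc k` rewrites the two parts, and Pascal's rule one level down reassembles them.
[1+k]*[1+n]C[1+k]≡[1+n]*nCk : ∀ n k → suc k * (suc n C suc k) ≡ suc n * (n C k)
[1+k]*[1+n]C[1+k]≡[1+n]*nCk n zero = begin
  1 * (suc n C 1)    ≡⟨ *-identityˡ _ ⟩
  suc n C 1          ≡⟨ nC1≡n (suc n) ⟩
  suc n              ≡⟨ *-identityʳ _ ⟨
  suc n * 1          ≡⟨ cong (suc n *_) (nC0≡1 n) ⟨
  suc n * (n C 0)    ∎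
  where open ≡-Reasoning
[1+k]*[1+n]C[1+k]≡[1+n]*nCk zero (suc k) = begin
  suc (suc k) * (1 C suc (suc k))  ≡⟨ cong (suc (suc k) *_) (k>n⇒nCk≡0 (s≤s (s≤s (z≤n {k})))) ⟩
  suc (suc k) * 0                  ≡⟨ *-zeroʳ (suc (suc k)) ⟩
  0                                ≡⟨ cong (1 *_) (k>n⇒nCk≡0 (s≤s (z≤n {k}))) ⟨
  1 * (0 C suc k)                  ∎
  where open ≡-Reasoning
[1+k]*[1+n]C[1+k]≡[1+n]*nCk (suc n) (suc k) = begin
  suc (suc k) * (suc (suc n) C suc (suc k))
    ≡⟨ cong (suc (suc k) *_) (nCk+nC[k+1]≡[n+1]C[k+1] (suc n) (suc k)) ⟨
  suc (suc k) * (a + b)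
    ≡⟨ expand k a b ⟩
  suc k * a + a + suc (suc k) * b
    ≡⟨ cong₂ (λ x y → x + a + y) ([1+k]*[1+n]C[1+k]≡[1+n]*nCk n k)
                                 ([1+k]*[1+n]C[1+k]≡[1+n]*nCk n (suc k)) ⟩
  suc n * (n C k) + a + suc n * (n C suc k)
    ≡⟨ collect n (n C k) (n C suc k) a ⟩
  suc n * (n C k + n C suc k) + a
    ≡⟨ cong (λ x → suc n * x + a) (nCk+nC[k+1]≡[n+1]C[k+1] n k) ⟩
  suc n * a + a
    ≡⟨ +-comm (suc n * a) a ⟩
  suc (suc n) * a ∎
  where
  open ≡-Reasoning
  a = suc n C suc k
  b = suc n C suc (suc k)
  expand : ∀ k a b → suc (suc k) * (a + b) ≡ suc k * a + a + suc (suc k) * b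
  expand = solve-∀
  collect : ∀ n x y a → suc n * x + a + suc n * y ≡ suc n * (x + y) + a
  collect = solve-∀

-- Pascal's rule and absorption give (k+1)(C(n,k) + C(n,k+1)) = (n+1) C(n,k), which is at most
-- 2(k+1) C(n,k). Subtracting (k+1) C(n,k) and cancelling k+1 leaves the claim.
nC[1+k]≤nCk : ∀ n k → suc n ≤ 2 * suc k → n C suc k ≤ n C k
nC[1+k]≤nCk n k 1+n≤2[1+k] = *-cancelˡ-≤ (suc k) (+-cancelˡ-≤ (suc k * x) _ _ (begin
  suc k * x + suc k * y  ≡⟨ *-distribˡ-+ (suc k) x y ⟨
  suc k * (x + y)        ≡⟨ cong (suc k *_) (nCk+nC[k+1]≡[n+1]C[k+1] n k) ⟩
  suc k * (suc n C suc k) ≡⟨ [1+k]*[1+n]C[1+k]≡[1+n]*nCk n k ⟩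
  suc n * x              ≤⟨ *-monoˡ-≤ x 1+n≤2[1+k] ⟩
  2 * suc k * x          ≡⟨ double (suc k) x ⟩
  suc k * x + suc k * x  ∎))
  where
  open ≤-Reasoning
  x = n C k
  y = n C suc k
  double : ∀ k x → 2 * k * x ≡ k * x + k * x
  double = solve-∀

-- The hypothesis forces k > 0 and puts k beyond the middle of row n, so of the two Pascal summands
-- of C(n+1,k) the one at k-1 is at least the one at k.
2*nCk≤[1+n]Ck : ∀ n k → suc n ≤ 2 * k → 2 * (n C k) ≤ suc n C k
2*nCk≤[1+n]Ck n (suc k) 1+n≤2k = begin
  2 * (n C suc k)            ≡⟨ cong (n C suc k +_) (+-identityʳ _) ⟩
  n C suc k + n C suc k      ≤⟨ +-monoˡ-≤ _ (nC[1+k]≤nCk n k 1+n≤2k) ⟩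
  n C k + n C suc k          ≡⟨ nCk+nC[k+1]≡[n+1]C[k+1] n k ⟩
  suc n C suc k              ∎
  where open ≤-Reasoning

-- As long as the upper index stays at most 2k, each increment at least doubles the coefficient.
-- This is what compares C(b,n) 2^(2n-b) with C(2n,n).
2^d*nCk≤[d+n]Ck : ∀ d n k → d + n ≤ 2 * k → 2 ^ d * (n C k) ≤ (d + n) C k
2^d*nCk≤[d+n]Ck zero    n k d+n≤2k = ≤-reflexive (*-identityˡ _)
2^d*nCk≤[d+n]Ck (suc d) n k d+n≤2k = begin
  2 * 2 ^ d * (n C k)    ≡⟨ *-assoc 2 (2 ^ d) _ ⟩
  2 * (2 ^ d * (n C k))  ≤⟨ *-monoʳ-≤ 2 (2^d*nCk≤[d+n]Ck d n k (≤-trans (n≤1+n _) d+n≤2k)) ⟩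
  2 * ((d + n) C k)      ≤⟨ 2*nCk≤[1+n]Ck (d + n) k d+n≤2k ⟩
  (suc d + n) C k        ∎
  where open ≤-Reasoning

-- Absorption is applied in rows 2n+2 and 2n+1, with the symmetry C(2n+1,n) = C(2n+1,n+1) in
-- between.
centralBinomial-recurrence : ∀ n → suc n * ((2 * suc n) C suc n) ≡ 2 * (suc (2 * n) * ((2 * n) C n))
centralBinomial-recurrence n = begin
  suc n * ((2 * suc n) C suc n)           ≡⟨ cong (λ m → suc n * (m C suc n)) (*-suc 2 n) ⟩
  suc n * (suc (suc (2 * n)) C suc n)     ≡⟨ [1+k]*[1+n]C[1+k]≡[1+n]*nCk (suc (2 * n)) n ⟩
  suc (suc (2 * n)) * (suc (2 * n) C n)   ≡⟨ cong (suc (suc (2 * n)) *_) symmetric ⟩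
  suc (suc (2 * n)) * (suc (2 * n) C suc n) ≡⟨ regroup n (suc (2 * n) C suc n) ⟩
  2 * (suc n * (suc (2 * n) C suc n))     ≡⟨ cong (2 *_) ([1+k]*[1+n]C[1+k]≡[1+n]*nCk (2 * n) n) ⟩
  2 * (suc (2 * n) * ((2 * n) C n))       ∎
  where
  open ≡-Reasoning
  1+2n : ∀ n → suc (2 * n) ≡ suc n + n
  1+2n = solve-∀
  regroup : ∀ n x → suc (suc (2 * n)) * x ≡ 2 * (suc n * x)
  regroup = solve-∀
  symmetric : suc (2 * n) C n ≡ suc (2 * n) C suc n
  symmetric = trans (nCk≡nC[n∸k] (≤-trans (m≤m+n n _) (n≤1+n _)))
    (cong (suc (2 * n) C_) (trans (cong (_∸ n) (1+2n n)) (m+n∸n≡m (suc n) n)))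

-- By the recurrence, passing from n to n+1 multiplies the left side by 4(2n+1)(2n+3)/(n+1)². Since
-- (2n+1)(2n+3) = 4(n+1)² - 1, this factor is below 16, the growth of the right side.
centralBinomial²-bound : ∀ n → let c = (2 * n) C n in c * c * suc (2 * n) ≤ 2 ^ (2 * n) * 2 ^ (2 * n)
centralBinomial²-bound zero = ≤-refl
centralBinomial²-bound (suc n) = *-cancelˡ-≤ (suc n * suc n) (begin
  suc n * suc n * (c′ * c′ * suc (2 * suc n))
    ≡⟨ square n c′ ⟩
  suc n * c′ * (suc n * c′) * suc (2 * suc n)
    ≡⟨ cong (λ x → x * x * suc (2 * suc n)) (centralBinomial-recurrence n) ⟩
  2 * (suc (2 * n) * c) * (2 * (suc (2 * n) * c)) * suc (2 * suc n)
    ≡⟨ regroup n c ⟩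
  4 * (suc (2 * n) * suc (2 * suc n)) * (c * c * suc (2 * n))
    ≤⟨ *-monoʳ-≤ (4 * (suc (2 * n) * suc (2 * suc n))) (centralBinomial²-bound n) ⟩
  4 * (suc (2 * n) * suc (2 * suc n)) * (t * t)
    ≤⟨ *-monoˡ-≤ (t * t) (*-monoʳ-≤ 4 (≤-trans (n≤1+n _) (≤-reflexive (differenceOfSquares n)))) ⟩
  4 * (4 * (suc n * suc n)) * (t * t)
    ≡⟨ distribute n t ⟩
  suc n * suc n * (4 * t * (4 * t))
    ≡⟨ cong (λ x → suc n * suc n * (x * x)) (trans (sym (^-distribˡ-+-* 2 2 (2 * n))) (cong (2 ^_) (sym (*-suc 2 n)))) ⟩
  suc n * suc n * (2 ^ (2 * suc n) * 2 ^ (2 * suc n)) ∎)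
  where
  open ≤-Reasoning
  c  = (2 * n) C n
  c′ = (2 * suc n) C suc n
  t  = 2 ^ (2 * n)
  square : ∀ n c → suc n * suc n * (c * c * suc (2 * suc n)) ≡ suc n * c * (suc n * c) * suc (2 * suc n)
  square = solve-∀
  regroup : ∀ n c → 2 * (suc (2 * n) * c) * (2 * (suc (2 * n) * c)) * suc (2 * suc n) ≡
                    4 * (suc (2 * n) * suc (2 * suc n)) * (c * c * suc (2 * n))
  regroup = solve-∀
  differenceOfSquares : ∀ n → suc (suc (2 * n) * suc (2 * suc n)) ≡ 4 * (suc n * suc n)
  differenceOfSquares = solve-∀
  distribute : ∀ n t → 4 * (4 * (suc n * suc n)) * (t * t) ≡ suc n * suc n * (4 * t * (4 * t))
  distribute = solve-∀

-- Counting in lists, Cartesian products and lists of vectors.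

count : ∀ {A : Set} {P : Pred A 0ℓ} → Decidable P → List A → ℕ
count P? xs = length (filter P? xs)

module _ {A : Set} {P : Pred A 0ℓ} (P? : Decidable P) where

  count-++ : ∀ xs ys → count P? (xs ++ ys) ≡ count P? xs + count P? ys
  count-++ xs ys = trans (cong length (filter-++ P? xs ys)) (length-++ (filter P? xs))

  count-map : ∀ {B : Set} (f : B → A) xs → count P? (map f xs) ≡ count (P? ∘ f) xs
  count-map f []       = refl
  count-map f (x ∷ xs) with does (P? (f x))
  ... | true  = cong suc (count-map f xs)
  ... | false = count-map f xs

  count-cong : ∀ {Q : Pred A 0ℓ} (Q? : Decidable Q) → (∀ x → does (P? x) ≡ does (Q? x)) →
               ∀ xs → count P? xs ≡ count Q? xs
  count-cong Q? eq []       = refl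
  count-cong Q? eq (x ∷ xs) rewrite eq x with does (Q? x)
  ... | true  = cong suc (count-cong Q? eq xs)
  ... | false = count-cong Q? eq xs

  -- The inequality is "proportion at most `c / w`" with denominators cleared. It holds on each
  -- slice `f x`, and both sides add up over the slices.
  count-cartesianProductWith-≤ : ∀ {B D : Set} (f : B → D → A) ys c w →
    (∀ x → count (P? ∘ f x) ys * w ≤ c * length ys) → ∀ xs →
    count P? (cartesianProductWith f xs ys) * w ≤ c * length (cartesianProductWith f xs ys)
  count-cartesianProductWith-≤ f ys c w bound []       = z≤n
  count-cartesianProductWith-≤ f ys c w bound (x ∷ xs) = begin
    count P? (map (f x) ys ++ zs) * w
      ≡⟨ cong (_* w) (trans (count-++ (map (f x) ys) zs) (cong (_+ count P? zs) (count-map (f x) ys))) ⟩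
    (count (P? ∘ f x) ys + count P? zs) * w
      ≡⟨ *-distribʳ-+ w (count (P? ∘ f x) ys) (count P? zs) ⟩
    count (P? ∘ f x) ys * w + count P? zs * w
      ≤⟨ +-mono-≤ (bound x) (count-cartesianProductWith-≤ f ys c w bound xs) ⟩
    c * length ys + c * length zs
      ≡⟨ *-distribˡ-+ c (length ys) (length zs) ⟨
    c * (length ys + length zs)
      ≡⟨ cong (c *_) (trans (length-++ (map (f x) ys)) (cong (_+ length zs) (length-map (f x) ys))) ⟨
    c * length (map (f x) ys ++ zs) ∎
    where
    open ≤-Reasoning
    zs = cartesianProductWith f xs ys

module _ {A B D : Set} where

  cartesianProductWith-∷ʳ : ∀ (f : A → B → D) xs y ys →
    cartesianProductWith f xs (y ∷ ys) ↭ map (flip f y) xs ++ cartesianProductWith f xs ys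
  cartesianProductWith-∷ʳ f []       y ys = ↭-refl
  cartesianProductWith-∷ʳ f (x ∷ xs) y ys = prep (f x y) (begin
    map (f x) ys ++ cartesianProductWith f xs (y ∷ ys)
      ↭⟨ ++⁺ˡ (map (f x) ys) (cartesianProductWith-∷ʳ f xs y ys) ⟩
    map (f x) ys ++ map (flip f y) xs ++ cartesianProductWith f xs ys
      ↭⟨ shifts (map (f x) ys) (map (flip f y) xs) ⟩
    map (flip f y) xs ++ map (f x) ys ++ cartesianProductWith f xs ys ∎)
    where open PermutationReasoning

  -- Counts are invariant under permutation, so either factor of a product may serve as the inner
  -- one that is counted with the other fixed.
  cartesianProductWith-flip : ∀ (f : A → B → D) xs ys →
    cartesianProductWith f xs ys ↭ cartesianProductWith (flip f) ys xs
  cartesianProductWith-flip f xs []       = ↭-reflexive (cartesianProductWith-zeroʳ f xs)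
  cartesianProductWith-flip f xs (y ∷ ys) = begin
    cartesianProductWith f xs (y ∷ ys)
      ↭⟨ cartesianProductWith-∷ʳ f xs y ys ⟩
    map (flip f y) xs ++ cartesianProductWith f xs ys
      ↭⟨ ++⁺ˡ (map (flip f y) xs) (cartesianProductWith-flip f xs ys) ⟩
    map (flip f y) xs ++ cartesianProductWith (flip f) ys xs ∎
    where open PermutationReasoning

-- Averaging over all coordinates but `i`: if each choice of them admits at most `c` values at `i`,
-- the proportion of vectors satisfying `P` is at most `c / length xs`. For `i` = 0 the factors are
-- swapped to make the head the inner one; otherwise the head is fixed and the induction moves into
-- the tail.
count-vecs-≤ : ∀ {A : Set} (xs : List A) c {k} (i : Fin k) {P : Pred (Vec A k) 0ℓ} (P? : Decidable P) →
  (∀ v → count (λ a → P? (v [ i ]≔ a)) xs ≤ c) →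
  count P? (vecs xs k) * length xs ≤ c * length (vecs xs k)
count-vecs-≤ []           c {suc k} _       P? bound = z≤n
count-vecs-≤ xs@(x₀ ∷ _) c {suc k} zero    P? bound = begin
  count P? (cartesianProductWith _∷_ xs vs) * length xs
    ≡⟨ cong (_* length xs) (↭-length (filter-↭ P? swapped)) ⟩
  count P? (cartesianProductWith (flip _∷_) vs xs) * length xs
    ≤⟨ count-cartesianProductWith-≤ P? (flip _∷_) xs c (length xs)
         -- The head `x₀` is a placeholder that the update at `zero` overwrites.
         (λ v → *-monoˡ-≤ (length xs) (bound (x₀ ∷ v))) vs ⟩
  c * length (cartesianProductWith (flip _∷_) vs xs)
    ≡⟨ cong (c *_) (↭-length swapped) ⟨
  c * length (cartesianProductWith _∷_ xs vs) ∎
  where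
  open ≤-Reasoning
  vs = vecs xs k
  swapped = cartesianProductWith-flip _∷_ xs vs
count-vecs-≤ xs           c {suc k} (suc i) P? bound =
  count-cartesianProductWith-≤ P? _∷_ (vecs xs k) c (length xs)
    (λ x → count-vecs-≤ xs c i (P? ∘ (x ∷_)) (bound ∘ (x ∷_))) xs

-- Subsets counted by the size of their trace on a fixed set.

literal : Bool → Bool → Bool
literal true  x = x
literal false x = not x

-- The set measured is A ∩ B when `b` is `true`, and B minus A when `b` is `false`.
traceSize? : ∀ {m} b (B : Subset m) j →
             Decidable (λ A → ∣ zipWith (λ x y → literal b x ∧ y) A B ∣ ≡ j)
traceSize? b B j A = ∣ zipWith (λ x y → literal b x ∧ y) A B ∣ ≟ j

traceCount : ∀ {m} → Bool → Subset m → ℕ → ℕ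
traceCount {m} b B j = count (traceSize? b B j) (vecs bools m)

module _ {m} {P : Pred (Subset (suc m)) 0ℓ} (P? : Decidable P) where

  count-subsets : count P? (vecs bools (suc m)) ≡
    count (P? ∘ (true ∷_)) (vecs bools m) + count (P? ∘ (false ∷_)) (vecs bools m)
  count-subsets = begin
    count P? (map (true ∷_) vs ++ map (false ∷_) vs ++ [])
      ≡⟨ count-++ P? (map (true ∷_) vs) _ ⟩
    count P? (map (true ∷_) vs) + count P? (map (false ∷_) vs ++ [])
      ≡⟨ cong (count P? (map (true ∷_) vs) +_) (trans (count-++ P? (map (false ∷_) vs) []) (+-identityʳ _)) ⟩
    count P? (map (true ∷_) vs) + count P? (map (false ∷_) vs)
      ≡⟨ cong₂ _+_ (count-map P? (true ∷_) vs) (count-map P? (false ∷_) vs) ⟩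
    count (P? ∘ (true ∷_)) vs + count (P? ∘ (false ∷_)) vs ∎
    where
    open ≡-Reasoning
    vs = vecs bools m

-- A point outside B never enters the trace, so both choices for it contribute equally.
traceCount-false : ∀ {m} b (B : Subset m) j → traceCount b (false ∷ B) j ≡ 2 * traceCount b B j
traceCount-false {m} b B j = begin
  traceCount b (false ∷ B) j
    ≡⟨ count-subsets (traceSize? b (false ∷ B) j) ⟩
  count (traceSize? b (false ∷ B) j ∘ (true ∷_)) vs + count (traceSize? b (false ∷ B) j ∘ (false ∷_)) vs
    ≡⟨ cong₂ _+_ (same b true) (same b false) ⟩
  traceCount b B j + traceCount b B j
    ≡⟨ cong (traceCount b B j +_) (+-identityʳ _) ⟨
  2 * traceCount b B j ∎
  where
  open ≡-Reasoning
  vs = vecs bools m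
  same : ∀ b x → count (traceSize? b (false ∷ B) j ∘ (x ∷_)) vs ≡ traceCount b B j
  same true  true  = refl
  same true  false = refl
  same false true  = refl
  same false false = refl

-- Only the choice that keeps the new point out of the trace can leave the trace empty; `b` decides
-- which choice that is.
traceCount-true-zero : ∀ {m} b (B : Subset m) → traceCount b (true ∷ B) 0 ≡ traceCount b B 0
traceCount-true-zero {m} b B = trans (count-subsets (traceSize? b (true ∷ B) 0)) (split b)
  where
  vs = vecs bools m
  split : ∀ b → count (traceSize? b (true ∷ B) 0 ∘ (true ∷_)) vs +
                count (traceSize? b (true ∷ B) 0 ∘ (false ∷_)) vs ≡ traceCount b B 0
  split true  = cong (_+ traceCount true B 0)
                  (cong length (filter-none (traceSize? true (true ∷ B) 0 ∘ (true ∷_)) (universal (λ _ ()) vs)))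
  split false = trans (cong (traceCount false B 0 +_)
                  (cong length (filter-none (traceSize? false (true ∷ B) 0 ∘ (false ∷_)) (universal (λ _ ()) vs))))
                  (+-identityʳ _)

-- Pascal's rule for traces: exactly one of the two choices for the new point puts it into the
-- trace.
traceCount-true-suc : ∀ {m} b (B : Subset m) j →
  traceCount b (true ∷ B) (suc j) ≡ traceCount b B j + traceCount b B (suc j)
traceCount-true-suc {m} b B j = trans (count-subsets (traceSize? b (true ∷ B) (suc j))) (split b)
  where
  vs = vecs bools m
  split : ∀ b → count (traceSize? b (true ∷ B) (suc j) ∘ (true ∷_)) vs +
                count (traceSize? b (true ∷ B) (suc j) ∘ (false ∷_)) vs ≡
                traceCount b B j + traceCount b B (suc j)
  split true  = cong (_+ traceCount true B (suc j))
    (count-cong (traceSize? true (true ∷ B) (suc j) ∘ (true ∷_)) (traceSize? true B j) (λ _ → refl) vs)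
  split false = trans (cong (traceCount false B (suc j) +_)
    (count-cong (traceSize? false (true ∷ B) (suc j) ∘ (false ∷_)) (traceSize? false B j) (λ _ → refl) vs))
    (+-comm _ (traceCount false B j))

-- The count is C(|B|,j) 2^(m-|B|), multiplied out to avoid subtraction. Points outside B double it,
-- and points of B make it follow Pascal's rule.
traceCount-binomial : ∀ {m} b (B : Subset m) j → traceCount b B j * 2 ^ ∣ B ∣ ≡ (∣ B ∣ C j) * 2 ^ m
traceCount-binomial b [] zero    = refl
traceCount-binomial b [] (suc j) = refl
traceCount-binomial {suc m} b (false ∷ B) j = begin
  traceCount b (false ∷ B) j * 2 ^ ∣ B ∣  ≡⟨ cong (_* 2 ^ ∣ B ∣) (traceCount-false b B j) ⟩
  2 * traceCount b B j * 2 ^ ∣ B ∣        ≡⟨ *-assoc 2 (traceCount b B j) _ ⟩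
  2 * (traceCount b B j * 2 ^ ∣ B ∣)      ≡⟨ cong (2 *_) (traceCount-binomial b B j) ⟩
  2 * ((∣ B ∣ C j) * 2 ^ m)               ≡⟨ swap (∣ B ∣ C j) (2 ^ m) ⟩
  (∣ B ∣ C j) * 2 ^ suc m                 ∎
  where
  open ≡-Reasoning
  swap : ∀ x y → 2 * (x * y) ≡ x * (2 * y)
  swap = solve-∀
traceCount-binomial {suc m} b (true ∷ B) zero = begin
  traceCount b (true ∷ B) 0 * 2 ^ suc ∣ B ∣  ≡⟨ cong (_* 2 ^ suc ∣ B ∣) (traceCount-true-zero b B) ⟩
  traceCount b B 0 * (2 * 2 ^ ∣ B ∣)         ≡⟨ swap (traceCount b B 0) _ ⟩
  2 * (traceCount b B 0 * 2 ^ ∣ B ∣)         ≡⟨ cong (2 *_) (traceCount-binomial b B 0) ⟩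
  2 * ((∣ B ∣ C 0) * 2 ^ m)                  ≡⟨ cong (λ x → 2 * (x * 2 ^ m)) (trans (nC0≡1 ∣ B ∣) (sym (nC0≡1 (suc ∣ B ∣)))) ⟩
  2 * ((suc ∣ B ∣ C 0) * 2 ^ m)              ≡⟨ swap (suc ∣ B ∣ C 0) (2 ^ m) ⟨
  (suc ∣ B ∣ C 0) * 2 ^ suc m                ∎
  where
  open ≡-Reasoning
  swap : ∀ x y → x * (2 * y) ≡ 2 * (x * y)
  swap = solve-∀
traceCount-binomial {suc m} b (true ∷ B) (suc j) = begin
  traceCount b (true ∷ B) (suc j) * 2 ^ suc ∣ B ∣
    ≡⟨ cong (_* 2 ^ suc ∣ B ∣) (traceCount-true-suc b B j) ⟩
  (traceCount b B j + traceCount b B (suc j)) * (2 * 2 ^ ∣ B ∣)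
    ≡⟨ distribute (traceCount b B j) _ _ ⟩
  2 * (traceCount b B j * 2 ^ ∣ B ∣ + traceCount b B (suc j) * 2 ^ ∣ B ∣)
    ≡⟨ cong₂ (λ x y → 2 * (x + y)) (traceCount-binomial b B j) (traceCount-binomial b B (suc j)) ⟩
  2 * ((∣ B ∣ C j) * 2 ^ m + (∣ B ∣ C suc j) * 2 ^ m)
    ≡⟨ distribute (∣ B ∣ C j) _ _ ⟨
  (∣ B ∣ C j + ∣ B ∣ C suc j) * (2 * 2 ^ m)
    ≡⟨ cong (_* 2 ^ suc m) (nCk+nC[k+1]≡[n+1]C[k+1] ∣ B ∣ j) ⟩
  (suc ∣ B ∣ C suc j) * 2 ^ suc m ∎
  where
  open ≡-Reasoning
  distribute : ∀ x y z → (x + y) * (2 * z) ≡ 2 * (x * z + y * z)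
  distribute = solve-∀

length-vecs-bools : ∀ m → length (vecs bools m) ≡ 2 ^ m
length-vecs-bools zero    = refl
length-vecs-bools (suc m) = begin
  length (map (true ∷_) vs ++ map (false ∷_) vs ++ [])
    ≡⟨ length-++ (map (true ∷_) vs) ⟩
  length (map (true ∷_) vs) + length (map (false ∷_) vs ++ [])
    ≡⟨ cong₂ _+_ (length-map (true ∷_) vs) (trans (length-++ (map (false ∷_) vs)) (cong (_+ 0) (length-map (false ∷_) vs))) ⟩
  2 * length vs
    ≡⟨ cong (2 *_) (length-vecs-bools m) ⟩
  2 ^ suc m ∎
  where
  open ≡-Reasoning
  vs = vecs bools m

traceCount-≤ : ∀ n b (B : Subset (2 * n)) → traceCount b B n ≤ (2 * n) C n
traceCount-≤ n b B = *-cancelʳ-≤ _ _ (2 ^ ∣ B ∣) {{m^n≢0 2 ∣ B ∣}} (begin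
  traceCount b B n * 2 ^ ∣ B ∣         ≡⟨ traceCount-binomial b B n ⟩
  (∣ B ∣ C n) * 2 ^ (2 * n)            ≡⟨ cong (λ m → (∣ B ∣ C n) * 2 ^ m) d+∣B∣≡2n ⟨
  (∣ B ∣ C n) * 2 ^ (d + ∣ B ∣)        ≡⟨ cong ((∣ B ∣ C n) *_) (^-distribˡ-+-* 2 d ∣ B ∣) ⟩
  (∣ B ∣ C n) * (2 ^ d * 2 ^ ∣ B ∣)    ≡⟨ regroup (∣ B ∣ C n) (2 ^ d) (2 ^ ∣ B ∣) ⟩
  2 ^ d * (∣ B ∣ C n) * 2 ^ ∣ B ∣      ≤⟨ *-monoˡ-≤ (2 ^ ∣ B ∣) (2^d*nCk≤[d+n]Ck d ∣ B ∣ n (≤-reflexive d+∣B∣≡2n)) ⟩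
  ((d + ∣ B ∣) C n) * 2 ^ ∣ B ∣        ≡⟨ cong (λ m → (m C n) * 2 ^ ∣ B ∣) d+∣B∣≡2n ⟩
  ((2 * n) C n) * 2 ^ ∣ B ∣            ∎)
  where
  open ≤-Reasoning
  -- The number of points outside B. Each accounts for a factor 2, absorbed by raising the upper
  -- index from |B| to 2n.
  d = 2 * n ∸ ∣ B ∣
  d+∣B∣≡2n : d + ∣ B ∣ ≡ 2 * n
  d+∣B∣≡2n = m∸n+n≡m (∣p∣≤n B)
  regroup : ∀ x y z → x * (y * z) ≡ y * x * z
  regroup = solve-∀

-- From a splitting of the property to a bound on its neutral structures.

SplitsAt : ∀ {k} → Fin k → Bool → Property k → (∀ {n} → Structure k n → Subset n) → Set
SplitsAt {k} i b φ B = ∀ {n} (M : Structure k n) A →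
  φ ⟨ M [ i ]≔ A ⟩ ≡ zipWith (λ x y → literal b x ∧ y) A (B M)

-- In `SplitsAt` the set `B M` is computed from `M` before the update, hence stays fixed while `A`
-- runs through all interpretations of the predicate `i`. At most C(2n,n) of them are neutral, and
-- averaging over `M` gives density at most C(2n,n) / 4^n.
neutralStructures-bound : ∀ {k} (i : Fin k) b φ (B : ∀ {n} → Structure k n → Subset n) → SplitsAt i b φ B →
  ∀ n → length (neutralStructures φ n) * 2 ^ (2 * n) ≤ ((2 * n) C n) * length (structures k (2 * n))
neutralStructures-bound {k} i b φ B splits n =
  subst (λ s → length (neutralStructures φ n) * s ≤ ((2 * n) C n) * length (structures k (2 * n)))
    (length-vecs-bools (2 * n))
    (count-vecs-≤ (vecs bools (2 * n)) ((2 * n) C n) i neutral? λ M → begin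
      count (λ A → neutral? (M [ i ]≔ A)) (vecs bools (2 * n))
        ≡⟨ count-cong (λ A → neutral? (M [ i ]≔ A)) (traceSize? b (B M) n)
             (λ A → cong (λ X → does (∣ X ∣ ≟ n)) (splits M A)) (vecs bools (2 * n)) ⟩
      traceCount b (B M) n
        ≤⟨ traceCount-≤ n b (B M) ⟩
      (2 * n) C n ∎)
  where
  open ≤-Reasoning
  neutral? = λ (M : Structure k (2 * n)) → ∣ φ ⟨ M ⟩ ∣ ≟ n

-- Convergence to 0 from a bound on squares.

square-cancel-< : ∀ {x y} → x * x ℕ.< y * y → x ℕ.< y
square-cancel-< {x} {y} x²<y² = ≰⇒> λ y≤x → <⇒≱ x²<y² (*-mono-≤ y≤x y≤x)

-- Since `/` reduces its fraction, the comparison passes through unnormalised rationals, where it is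
-- plain cross-multiplication.
fraction-< : ∀ a b p d .{{_ : NonZero b}} .(c : Coprime p (suc d)) →
  a * suc d ℕ.< p * b → (ℤ.+ a / b) <ℚ mkℚ (ℤ.+ p) d c
fraction-< a (suc b) p d c a*d<p*b = ℚ.toℚᵘ-cancel-< (ℚᵘ.<-respˡ-≃ (ℚᵘ.≃-sym (ℚ.toℚᵘ-fromℚᵘ (mkℚᵘ (ℤ.+ a) b)))
  (*<* (subst₂ ℤ._<_ (ℤ.pos-* a (suc d)) (ℤ.pos-* p (suc b)) (ℤ.+<+ a*d<p*b))))

abs-fraction : ∀ a b .{{_ : NonZero b}} → abs ((ℤ.+ a / b) - 0ℚ) ≡ ℤ.+ a / b
abs-fraction a b = trans (cong abs (ℚ.+-identityʳ (ℤ.+ a / b)))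
  (ℚ.0≤p⇒∣p∣≡p (ℚ.nonNegative⁻¹ (ℤ.+ a / b) {{ℚ.normalize-nonNeg a b}}))

-- The hypothesis says that the squared fraction is at most 1/(2n+1).
⟶0-criterion : (a b : ℕ → ℕ) (b≢0 : ∀ n → NonZero (b n)) →
  (∀ n → a n * a n * suc (2 * n) ≤ b n * b n) →
  (λ n → (ℤ.+ a n / b n) {{b≢0 n}}) ⟶ 0ℚ
⟶0-criterion a b b≢0 bound (mkℚ (ℤ.+ zero) d c) (*<*ℚ (ℤ.+<+ ()))
-- For ε with denominator q and positive numerator it is enough to get below 1/q. If n ≥ q² then q²
-- < 2n+1, whence (a q)² < b² and a q < b.
⟶0-criterion a b b≢0 bound (mkℚ (ℤ.+ suc p) d c) 0<ε = q * q , λ n n≥q² →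
  subst (_<ℚ mkℚ (ℤ.+ suc p) d c) (sym (abs-fraction (a n) (b n) {{b≢0 n}}))
    (fraction-< (a n) (b n) (suc p) d {{b≢0 n}} c
      (<-≤-trans (square-cancel-< (squares n n≥q²)) (m≤m+n (b n) (p * b n))))
  where
  open ≤-Reasoning
  q = suc d
  swap : ∀ x y → x * y * (x * y) ≡ x * x * (y * y)
  swap = solve-∀
  squares : ∀ n → q * q ≤ n → a n * q * (a n * q) ℕ.< b n * b n
  squares n q²≤n with a n | b n | b≢0 n | bound n
  -- With numerator 0 the strict inequality comes from b > 0, since multiplying by a² = 0 would lose
  -- it.
  ... | zero  | suc y | _ | _ = s≤s z≤n
  ... | suc x | y     | _ | x²[1+2n]≤y² = begin-strict
    suc x * q * (suc x * q)           ≡⟨ swap (suc x) q ⟩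
    suc x * suc x * (q * q)           <⟨ *-monoʳ-< (suc x * suc x) (s≤s (≤-trans q²≤n (m≤m+n n _))) ⟩
    suc x * suc x * suc (2 * n)       ≤⟨ x²[1+2n]≤y² ⟩
    y * y                             ∎

-- With density x/y, the bounds x t ≤ c y and c² (2n+1) ≤ t² combine, after cancelling t², to x²
-- (2n+1) ≤ y².
split⇒regular : ∀ {k} (i : Fin k) b φ (B : ∀ {n} → Structure k n → Subset n) → SplitsAt i b φ B → Regular φ
split⇒regular {k} i b φ B splits =
  ⟶0-criterion (λ n → length (neutralStructures φ n)) (λ n → length (structures k (2 * n)))
    (λ n → structures-nonZero k (2 * n)) bound
  where
  open ≤-Reasoning
  regroup : ∀ x z t → t * t * (x * x * z) ≡ x * t * (x * t) * z
  regroup = solve-∀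
  regroup′ : ∀ c y z → c * y * (c * y) * z ≡ c * c * z * (y * y)
  regroup′ = solve-∀
  bound : ∀ n → let x = length (neutralStructures φ n); y = length (structures k (2 * n)) in
          x * x * suc (2 * n) ≤ y * y
  bound n = *-cancelˡ-≤ (t * t) {{m*n≢0 t t {{t≢0}} {{t≢0}}}} (begin
    t * t * (x * x * suc (2 * n))       ≡⟨ regroup x (suc (2 * n)) t ⟩
    x * t * (x * t) * suc (2 * n)       ≤⟨ *-monoˡ-≤ (suc (2 * n)) (*-mono-≤ xt≤cy xt≤cy) ⟩
    c * y * (c * y) * suc (2 * n)       ≡⟨ regroup′ c y (suc (2 * n)) ⟩
    c * c * suc (2 * n) * (y * y)       ≤⟨ *-monoˡ-≤ (y * y) (centralBinomial²-bound n) ⟩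
    t * t * (y * y)                     ∎)
    where
    x = length (neutralStructures φ n)
    y = length (structures k (2 * n))
    c = (2 * n) C n
    t = 2 ^ (2 * n)
    t≢0 = m^n≢0 2 (2 * n)
    xt≤cy = neutralStructures-bound i b φ B splits n

-- Basic properties split at their first index.

does-∈? : ∀ {n} (x : Fin n) (p : Subset n) → does (x ∈? p) ≡ lookup p x
does-∈? zero    (true  ∷ p) = refl
does-∈? zero    (false ∷ p) = refl
does-∈? (suc x) (_     ∷ p) = does-∈? x p

module _ {k} (e : Fin k → Bool) where

  does-U^ : ∀ i {n} (M : Structure k n) a →
            does (M ⊨? U^[ e i ] i [ a ∷ [] ]) ≡ literal (e i) (lookup (lookup M i) a)
  does-U^ i M a with e i
  ... | true  = does-∈? a (lookup M i)
  ... | false = cong not (does-∈? a (lookup M i))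

  does-U^-cong : ∀ {n} (M M′ : Structure k n) a i → lookup M i ≡ lookup M′ i →
    does (M ⊨? U^[ e i ] i [ a ∷ [] ]) ≡ does (M′ ⊨? U^[ e i ] i [ a ∷ [] ])
  does-U^-cong M M′ a i eq = trans (does-U^ i M a)
    (trans (cong (λ A → literal (e i) (lookup A a)) eq) (sym (does-U^ i M′ a)))

  -- A conjunction reads only the predicates it lists. Applied to the tail, it shows that changing
  -- the interpretation of the first predicate leaves the other conjuncts unaffected.
  does-basic-cong : ∀ {n} (M M′ : Structure k n) a {p} i (s : Vec (Fin k) p) →
    All (λ j → lookup M j ≡ lookup M′ j) (i ∷ s) →
    does (M ⊨? basic (i ∷ s) e [ a ∷ [] ]) ≡ does (M′ ⊨? basic (i ∷ s) e [ a ∷ [] ])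
  does-basic-cong M M′ a i []      (eq ∷ [])    = does-U^-cong M M′ a i eq
  does-basic-cong M M′ a i (j ∷ s) (eq ∷ agree) =
    cong₂ _∧_ (does-U^-cong M M′ a i eq) (does-basic-cong M M′ a j s agree)

  rest : ∀ {p n} → Vec (Fin k) p → Structure k n → Subset n
  rest []      M = replicate _ true
  rest (j ∷ s) M = basic (j ∷ s) e ⟨ M ⟩

  basic-splits : ∀ {p} i (s : Vec (Fin k) p) → All (i ≢_) s →
    SplitsAt i (e i) (basic (i ∷ s) e) (rest s)
  basic-splits i s i∉s M A = trans (tabulate-cong (pointwise s i∉s)) (tabulate∘lookup _)
    where
    M′ = M [ i ]≔ A
    head : ∀ a → does (M′ ⊨? U^[ e i ] i [ a ∷ [] ]) ≡ literal (e i) (lookup A a)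
    head a = trans (does-U^ i M′ a) (cong (λ X → literal (e i) (lookup X a)) (lookup∘updateAt i M))
    pointwise : ∀ {p} (s : Vec (Fin k) p) → All (i ≢_) s → ∀ a →
      does (M′ ⊨? basic (i ∷ s) e [ a ∷ [] ]) ≡
      lookup (zipWith (λ x y → literal (e i) x ∧ y) A (rest s M)) a
    pointwise [] _ a = begin
      does (M′ ⊨? U^[ e i ] i [ a ∷ [] ])       ≡⟨ head a ⟩
      literal (e i) (lookup A a)                ≡⟨ ∧-identityʳ _ ⟨
      literal (e i) (lookup A a) ∧ true         ≡⟨ cong (literal (e i) (lookup A a) ∧_) (lookup-replicate a true) ⟨
      literal (e i) (lookup A a) ∧ lookup (replicate _ true) a ≡⟨ lookup-zipWith _ a A _ ⟨
      _ ∎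
      where open ≡-Reasoning
    pointwise (j ∷ s) i∉s a = begin
      does (M′ ⊨? U^[ e i ] i [ a ∷ [] ]) ∧ does (M′ ⊨? basic (j ∷ s) e [ a ∷ [] ])
        ≡⟨ cong₂ _∧_ (head a) (does-basic-cong M′ M a j s
             (All.map (λ {l} i≢l → lookup∘updateAt′ l i (i≢l ∘ sym) M) i∉s)) ⟩
      literal (e i) (lookup A a) ∧ does (M ⊨? basic (j ∷ s) e [ a ∷ [] ])
        ≡⟨ cong (literal (e i) (lookup A a) ∧_) (lookup∘tabulate _ a) ⟨
      literal (e i) (lookup A a) ∧ lookup (rest (j ∷ s) M) a
        ≡⟨ lookup-zipWith _ a A _ ⟨
      _ ∎
      where open ≡-Reasoning

  basic-regular : ∀ {p} i (s : Vec (Fin k) p) → All (i ≢_) s → Regular (basic (i ∷ s) e)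
  basic-regular i s i∉s = split⇒regular i (e i) (basic (i ∷ s) e) (rest s) (basic-splits i s i∉s)

theorem3p7 : (k : ℕ) .{{_ : NonZero k}} →
    ((p : ℕ) .{{_ : NonZero p}} → p ≤ k →
    (s : Vec (Fin k) p) → AllPairs _<_ s →
    (e : Fin k → Bool) → Regular (basic s e))
    × ((e : Fin k → Bool) → Regular (basic (allFin k) e))
    × ((i : Fin k) → Regular (U^[ true ] i) × Regular (U^[ false ] i))
theorem3p7 k@(suc _) =
    -- Strict increase makes the first index differ from all later ones.
    (λ { (suc _) _ (i ∷ s) (i<s ∷ _) e → basic-regular e i s (All.map <⇒≢ i<s) })
  , (λ e → basic-regular e zero (tabulate suc) (All.tabulate⁺ λ _ ()))
  -- A single literal is the basic property of a one-entry list, with a constant sign function.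
  , (λ i → basic-regular (λ _ → true) i [] [] , basic-regular (λ _ → false) i [] [])
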